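{- For the problem of scheduling with uncertain processing times on a single machine with the objective of minimizing the total completion time, the algorithm $(\alpha,\beta)$-SORT with $\alpha=\beta=\sqrt2$ is $(1+\sqrt2)$-competitive. Moreover, this choice of $\alpha$ and $\beta$ is optimal for the expression $$\max\left\{\alpha\left(1+\tfrac1\beta\right),\ 1+\tfrac1\alpha+\tfrac1\beta,\ 1+\beta,\ 2,\ 1+\tfrac2\alpha\right\},$$ i.e. it minimizes this expression over all choices of the parameters $\alpha,\beta\ge1$.
   Context: Problem. There are $n$ jobs, all available at time $0$. Job $j$ has a testing time $t_j\ge 0$, an upper limit $u_j\ge 0$, and a real processing time $p_j\in[0,u_j]$. A job may be executed untested, which takes $u_j$ time units, or it may be tested (taking $t_j$ time units) and later executed in $p_j$ time units; other tasks may run between the test and the execution. A single machine runs one task at a time. The completion time of a job is the time at which its execution (or execution-untested) ends, and the cost of a schedule is the sum of the completion times of all jobs. An online algorithm knows all $t_j,u_j$ from the start, but learns $p_j$ only when the test of $j$ is finished. $\mathrm{OPT}$ knows all $p_j$ in advance (but must still test $j$ in order to run it in time $p_j$), and its cost is the minimum cost of any schedule. An algorithm $A$ is $c$-competitive if $\mathrm{cost}(A)\le c\cdot \mathrm{cost}(\mathrm{OPT})$ on all instances. Algorithm $(\alpha,\beta)$-SORT. Maintain a priority queue of tasks, smaller weight meaning higher priority (ties broken arbitrarily). Initially, for each job $j$: if $u_j\ge\alpha t_j$, insert a testing task of weight $\beta t_j$; otherwise insert an execution-untested task of weight $u_j$. While the queue is nonempty, extract a task of smallest weight and run it; if it was the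 testing task of job $j$, then after the test insert an execution task for $j$ with weight $p_j$. -}

module Defs where

open import Level using (Level; _⊔_) renaming (suc to lsuc)
open import Algebra.Bundles using (CommutativeRing)
import Algebra.Properties.CommutativeMonoid.Sum as Sum
import Algebra.Construct.NaturalChoice.Max as Max
open import Data.Bool.Base using (Bool; false; if_then_else_)
open import Data.Fin.Base using (Fin)
open import Data.Fin.Properties using (_≟_)
open import Data.List.Base using (List; []; _∷_; _++_; map; filter; allFin)
open import Data.List.Relation.Unary.All using (All)
open import Data.List.Relation.Binary.Permutation.Propositional using (_↭_)
open import Data.Nat.Base using (ℕ)
open import Data.Product.Base using (_×_)
open import Data.Sum.Base using (_⊎_)
open import Relation.Binary.Bundles using (DecTotalOrder)
open import Relation.Binary.Core using (Rel)
open import Relation.Binary.PropositionalEquality using (_≡_)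
open import Relation.Binary.Structures using (IsDecTotalOrder)
open import Relation.Nullary.Decidable.Core using (does)
open import Relation.Nullary.Negation.Core using (¬_)

-- A linearly ordered field in which every nonnegative element has a square
-- root.  The real numbers are one; no further property of ℝ is assumed.
-- _⁻¹ and √_ are total, with unspecified values at 0# and at negative
-- elements respectively.
record EuclideanField (c ℓ₁ ℓ₂ : Level) : Set (lsuc (c ⊔ ℓ₁ ⊔ ℓ₂)) where
  field
    commutativeRing : CommutativeRing c ℓ₁

  open CommutativeRing commutativeRing public

  infix  4 _≤_
  infix  8 _⁻¹
  infix  9 √_

  field
    _≤_             : Rel Carrier ℓ₂
    isDecTotalOrder : IsDecTotalOrder _≈_ _≤_
    0≉1             : ¬ (0# ≈ 1#)
    _⁻¹             : Carrier → Carrier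
    ⁻¹-inverseʳ     : ∀ x → ¬ (x ≈ 0#) → x * x ⁻¹ ≈ 1#
    +-monoˡ-≤       : ∀ {x y} z → x ≤ y → x + z ≤ y + z
    *-nonNeg        : ∀ {x y} → 0# ≤ x → 0# ≤ y → 0# ≤ x * y
    √_              : Carrier → Carrier
    √-nonNeg        : ∀ {x} → 0# ≤ x → 0# ≤ √ x
    √-square        : ∀ {x} → 0# ≤ x → √ x * √ x ≈ x

  decTotalOrder : DecTotalOrder c ℓ₁ ℓ₂
  decTotalOrder = record { isDecTotalOrder = isDecTotalOrder }

  open DecTotalOrder decTotalOrder public using (_≤?_; totalOrder)

  2# : Carrier
  2# = 1# + 1#

module Scheduling {c ℓ₁ ℓ₂} (R : EuclideanField c ℓ₁ ℓ₂) where

  open EuclideanField R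
  open Sum +-commutativeMonoid using (sum)
  open Max totalOrder using () renaming (_⊔_ to max)

  record Instance : Set (c ⊔ ℓ₂) where
    field
      n   : ℕ
      t u p : Fin n → Carrier
      0≤t : ∀ j → 0# ≤ t j
      0≤u : ∀ j → 0# ≤ u j
      0≤p : ∀ j → 0# ≤ p j
      p≤u : ∀ j → p j ≤ u j

  data Task (n : ℕ) : Set where
    test     : Fin n → Task n
    execute  : Fin n → Task n
    untested : Fin n → Task n

  job : ∀ {n} → Task n → Fin n
  job (test j)     = j
  job (execute j)  = j
  job (untested j) = j

  completes : ∀ {n} → Task n → Fin n → Bool
  completes (test _)     _ = false
  completes (execute i)  j = does (i ≟ j)
  completes (untested i) j = does (i ≟ j)

  -- What the machine does, in chronological order starting at time 0.
  data Action (n : ℕ) : Set (c ⊔ ℓ₂) where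
    run  : Task n → Action n
    idle : (d : Carrier) → 0# ≤ d → Action n

  Schedule : ℕ → Set (c ⊔ ℓ₂)
  Schedule n = List (Action n)

  tasks : ∀ {n} → Schedule n → List (Task n)
  tasks []             = []
  tasks (run τ ∷ s)    = τ ∷ tasks s
  tasks (idle _ _ ∷ s) = tasks s

  tasksOf : ∀ {n} → Fin n → Schedule n → List (Task n)
  tasksOf j s = filter (λ τ → job τ ≟ j) (tasks s)

  Feasible : ∀ {n} → Schedule n → Set
  Feasible {n} s = (j : Fin n) →
    tasksOf j s ≡ untested j ∷ [] ⊎ tasksOf j s ≡ test j ∷ execute j ∷ []

  module _ (I : Instance) where
    open Instance I

    duration : Task n → Carrier
    duration (test j)     = t j
    duration (execute j)  = p j
    duration (untested j) = u j

    -- The completion time of a job when the schedule is started at a given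
    -- time.  The value 0# is reached only if the job is never executed, which
    -- feasibility excludes.
    completionFrom : Carrier → Schedule n → Fin n → Carrier
    completionFrom now []             j = 0#
    completionFrom now (idle d _ ∷ s) j = completionFrom (now + d) s j
    completionFrom now (run τ ∷ s)    j =
      if completes τ j then now + duration τ
                       else completionFrom (now + duration τ) s j

    completion : Schedule n → Fin n → Carrier
    completion = completionFrom 0#

    cost : Schedule n → Carrier
    cost s = sum (completion s)

    record IsOptimal (s : Schedule n) : Set (c ⊔ ℓ₂) where
      field
        feasible : Feasible s
        minimal  : ∀ s′ → Feasible s′ → cost s ≤ cost s′

  -- An algorithm is given by the schedules it may output on each instance;
  -- there can be several because ties may be broken arbitrarily.
  Algorithm : Set (lsuc (c ⊔ ℓ₂))
  Algorithm = (I : Instance) → Schedule (Instance.n I) → Set (c ⊔ ℓ₂)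

  Competitive : Algorithm → Carrier → Set (c ⊔ ℓ₂)
  Competitive A ρ = ∀ I s → A I s →
    Feasible s × (∀ opt → IsOptimal I opt → cost I s ≤ ρ * cost I opt)

  module _ (α β : Carrier) (I : Instance) where
    open Instance I

    weight : Task n → Carrier
    weight (test j)     = β * t j
    weight (execute j)  = p j
    weight (untested j) = u j

    initialTask : Fin n → Task n
    initialTask j = if does (α * t j ≤? u j) then test j else untested j

    followUp : Task n → List (Task n)
    followUp (test j)     = execute j ∷ []
    followUp (execute _)  = []
    followUp (untested _) = []

    -- SortRun Q s: from queue contents Q, in any order, the algorithm may
    -- run the schedule s.
    data SortRun : List (Task n) → Schedule n → Set (c ⊔ ℓ₂) where
      stop    : SortRun [] []
      extract : ∀ {Q Q′ τ s} →
                Q ↭ τ ∷ Q′ →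
                All (λ σ → weight τ ≤ weight σ) Q′ →
                SortRun (followUp τ ++ Q′) s →
                SortRun Q (run τ ∷ s)

  SORT : Carrier → Carrier → Algorithm
  SORT α β I = SortRun α β I (map (initialTask α β I) (allFin (Instance.n I)))

  ratioBound : Carrier → Carrier → Carrier
  ratioBound α β =
    max (α * (1# + β ⁻¹))
    (max (1# + α ⁻¹ + β ⁻¹)
    (max (1# + β)
    (max 2#
         (1# + 2# * α ⁻¹))))

  record IsMinimizer (f : Carrier → Carrier → Carrier) (α β : Carrier) :
                     Set (c ⊔ ℓ₂) where
    field
      1≤α     : 1# ≤ α
      1≤β     : 1# ≤ β
      minimal : ∀ α′ β′ → 1# ≤ α′ → 1# ≤ β′ → f α β ≤ f α′ β′

-- Writing s = √2, the cost of a schedule without idle time is the sum, over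
-- all ordered pairs (i, j), of the time spent on job i up to the completion of
-- job j.  For two jobs i ≠ j the sum of the two mutual delays is, in a feasible
-- schedule, at least the total work on i or the total work on j, whichever is
-- completed first.  A run of SORT restricted to {i, j} is a run of SORT on those
-- two jobs alone, so there are only a few interleavings to consider, and in each
-- the mutual delays are at most 1 + s times the work on either job.
--
-- The minimum of the ratio bound is attained at (s, s) because the term 1 + β is
-- large for β ≥ s, the term 1 + 2/α for α ≤ s, and the term α (1 + 1/β) for
-- β ≤ s and α ≥ s.

module Submission where

open import Defs
open import Level using (Level; _⊔_)
import Algebra.Construct.NaturalChoice.Max as Max
import Algebra.Construct.NaturalChoice.MaxOp as MaxOp
import Algebra.Properties.Ring as RingProperties
import Algebra.Properties.Semiring.Sum as Sum
import Algebra.Solver.Ring.NaturalCoefficients.Default as Solver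
open import Data.Bool.Base using (true; false; if_then_else_)
open import Data.Fin.Base using (Fin; suc; punchIn)
open import Data.Fin.Properties using (_≟_; punchInᵢ≢i)
open import Data.List.Base using (List; []; _∷_; _++_; map; filter; allFin)
open import Data.List.Membership.Propositional using (_∈_; lose)
open import Data.List.Membership.Propositional.Properties
  using (∈-allFin; ∈-filter⁻; ∈-filter⁺)
open import Data.List.Membership.Propositional.Properties.WithK using (unique∧set⇒bag)
open import Data.List.Properties
  using (++-identityʳ; filter-accept; filter-all; filter-none; filter-reject; filter-++)
open import Data.List.Relation.Binary.BagAndSetEquality using (∼bag⇒↭)
open import Data.List.Relation.Binary.Permutation.Propositional
  using (_↭_; ↭-refl; ↭-reflexive; ↭-sym; ↭-trans; swap)
open import Data.List.Relation.Binary.Permutation.Propositional.Properties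
  using (All-resp-↭; filter-↭; ↭-empty-inv; ↭-singleton-inv; ∈-resp-↭; drop-∷; map⁺)
open import Data.List.Relation.Unary.All as All using (All; []; _∷_)
open import Data.List.Relation.Unary.All.Properties as All using ()
open import Data.List.Relation.Unary.Any using (Any; here; there)
open import Data.List.Relation.Unary.Unique.Propositional using (Unique; []; _∷_)
import Data.List.Relation.Unary.Unique.Propositional.Properties as Unique
open import Data.Nat.Base as ℕ using (suc)
open import Data.Product.Base using (_×_; _,_; ∃; proj₁; proj₂)
open import Data.Sum.Base as Sum⊎ using (_⊎_; inj₁; inj₂; [_,_]′)
open import Function.Base using (_∘_; id)
open import Function.Bundles using (mk⇔)
open import Relation.Binary.Bundles using (DecTotalOrder)
import Relation.Binary.Reasoning.PartialOrder as ≤-Reasoning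
open import Relation.Binary.PropositionalEquality as ≡ using (_≡_; _≢_; ≢-sym)
open import Relation.Nullary.Decidable using (does; yes; no; dec-true; dec-false; _⊎-dec_)
open import Relation.Nullary.Negation.Core using (¬_; contradiction)
open import Relation.Unary using (Pred; Decidable)

-- Arithmetic in an ordered field.

module OrderedField {c ℓ₁ ℓ₂ : Level} (R : EuclideanField c ℓ₁ ℓ₂) where

  open EuclideanField R
  open DecTotalOrder decTotalOrder public using (poset; total; antisym)
    renaming (refl to ≤-refl; trans to ≤-trans; reflexive to ≤-reflexive)
  open RingProperties ring using (-1*x≈-x; -‿involutive)
  open Solver commutativeSemiring
  open ≤-Reasoning poset

  +-monoʳ-≤ : ∀ z {x y} → x ≤ y → z + x ≤ z + y
  +-monoʳ-≤ z {x} {y} x≤y = begin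
    z + x ≈⟨ +-comm z x ⟩
    x + z ≤⟨ +-monoˡ-≤ z x≤y ⟩
    y + z ≈⟨ +-comm y z ⟩
    z + y ∎

  +-mono-≤ : ∀ {x y z w} → x ≤ y → z ≤ w → x + z ≤ y + w
  +-mono-≤ {y = y} {z = z} x≤y z≤w = ≤-trans (+-monoˡ-≤ z x≤y) (+-monoʳ-≤ y z≤w)

  +-nonNeg : ∀ {x y} → 0# ≤ x → 0# ≤ y → 0# ≤ x + y
  +-nonNeg 0≤x 0≤y = ≤-trans (≤-reflexive (sym (+-identityʳ 0#))) (+-mono-≤ 0≤x 0≤y)

  x≤x+y : ∀ {x y} → 0# ≤ y → x ≤ x + y
  x≤x+y {x} 0≤y = ≤-trans (≤-reflexive (sym (+-identityʳ x))) (+-monoʳ-≤ x 0≤y)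

  x≤y+x : ∀ {x y} → 0# ≤ y → x ≤ y + x
  x≤y+x {x} {y} 0≤y = ≤-trans (x≤x+y 0≤y) (≤-reflexive (+-comm x y))

  +-cancelʳ-≤ : ∀ {x y} z → x + z ≤ y + z → x ≤ y
  +-cancelʳ-≤ {x} {y} z x+z≤y+z = begin
    x                ≈⟨ collapse x ⟨
    x + z + - z      ≤⟨ +-monoˡ-≤ (- z) x+z≤y+z ⟩
    y + z + - z      ≈⟨ collapse y ⟩
    y                ∎
    where
    collapse : ∀ w → w + z + - z ≈ w
    collapse w = trans (+-assoc w z (- z))
                (trans (+-congˡ (-‿inverseʳ z)) (+-identityʳ w))

  x≤y⇒0≤y-x : ∀ {x y} → x ≤ y → 0# ≤ y + - x
  x≤y⇒0≤y-x {x} {y} x≤y = begin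
    0#       ≈⟨ -‿inverseʳ x ⟨
    x + - x  ≤⟨ +-monoˡ-≤ (- x) x≤y ⟩
    y + - x  ∎

  y+[x-y]≈x : ∀ x y → y + (x + - y) ≈ x
  y+[x-y]≈x x y = trans (solve 3 (λ x y m → y :+ (x :+ m) := x :+ (y :+ m)) refl x y (- y))
                 (trans (+-congˡ (-‿inverseʳ y)) (+-identityʳ x))

  *-monoʳ-≤ : ∀ {z x y} → 0# ≤ z → x ≤ y → z * x ≤ z * y
  *-monoʳ-≤ {z} {x} {y} 0≤z x≤y = begin
    z * x                  ≤⟨ x≤x+y (*-nonNeg 0≤z (x≤y⇒0≤y-x x≤y)) ⟩
    z * x + z * (y + - x)  ≈⟨ distribˡ z x (y + - x) ⟨
    z * (x + (y + - x))    ≈⟨ *-congˡ (y+[x-y]≈x y x) ⟩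
    z * y                  ∎

  *-monoˡ-≤ : ∀ {z x y} → 0# ≤ z → x ≤ y → x * z ≤ y * z
  *-monoˡ-≤ {z} {x} {y} 0≤z x≤y = begin
    x * z  ≈⟨ *-comm x z ⟩
    z * x  ≤⟨ *-monoʳ-≤ 0≤z x≤y ⟩
    z * y  ≈⟨ *-comm z y ⟩
    y * z  ∎

  -- Positivity of `z` enters as `1# ≤ z`, so that `z` is `1# + k` with `0# ≤ k`. If `y ≤ x`, then
  -- `k * y ≤ k * x` turns the hypothesis into `x + k * x ≤ y + k * x`, and `k * x` cancels.
  *-cancelˡ-≤ : ∀ {z x y} → 1# ≤ z → z * x ≤ z * y → x ≤ y
  *-cancelˡ-≤ {z} {x} {y} 1≤z zx≤zy with total x y
  ... | inj₁ x≤y = x≤y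
  ... | inj₂ y≤x = +-cancelʳ-≤ (k * x) (begin
    x + k * x      ≈⟨ expand x ⟩
    z * x          ≤⟨ zx≤zy ⟩
    z * y          ≈⟨ expand y ⟨
    y + k * y      ≤⟨ +-monoʳ-≤ y (*-monoʳ-≤ (x≤y⇒0≤y-x 1≤z) y≤x) ⟩
    y + k * x      ∎)
    where
    k : Carrier
    k = z + - 1#

    expand : ∀ w → w + k * w ≈ z * w
    expand w = trans (solve 2 (λ w k → w :+ k :* w := (con 1 :+ k) :* w) refl w k)
                     (*-congʳ (y+[x-y]≈x z 1#))

  x+x≤y+y⇒x≤y : ∀ {x y} → x + x ≤ y + y → x ≤ y
  x+x≤y+y⇒x≤y {x} {y} 2x≤2y with total x y
  ... | inj₁ x≤y = x≤y
  ... | inj₂ y≤x = +-cancelʳ-≤ x (≤-trans 2x≤2y (+-monoʳ-≤ y y≤x))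

  0≤1 : 0# ≤ 1#
  0≤1 with total 0# 1#
  ... | inj₁ 0≤1 = 0≤1
  ... | inj₂ 1≤0 = begin
    0#           ≤⟨ *-nonNeg 0≤-1 0≤-1 ⟩
    - 1# * - 1#  ≈⟨ -1*x≈-x (- 1#) ⟩
    - - 1#       ≈⟨ -‿involutive 1# ⟩
    1#           ∎
    where
    0≤-1 : 0# ≤ - 1#
    0≤-1 = ≤-trans (x≤y⇒0≤y-x 1≤0) (≤-reflexive (+-identityˡ (- 1#)))

  0≤2 : 0# ≤ 2#
  0≤2 = +-nonNeg 0≤1 0≤1

  2≰1 : ¬ (2# ≤ 1#)
  2≰1 2≤1 = 0≉1 (antisym 0≤1 (+-cancelʳ-≤ 1# (≤-trans 2≤1 (≤-reflexive (sym (+-identityˡ 1#))))))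

-- The square root of 2 and the minimum of the ratio bound.

module SquareRootOf2 {c ℓ₁ ℓ₂ : Level} (R : EuclideanField c ℓ₁ ℓ₂) where

  open EuclideanField R
  open Scheduling R
  open OrderedField R
  open Max totalOrder using () renaming (_⊔_ to max)
  open MaxOp (Max.maxOperator totalOrder) using (⊔-lub; x≤x⊔y; x≤y⊔x)
  open Solver commutativeSemiring
  open ≤-Reasoning poset

  s : Carrier
  s = √ 2#

  0≤s : 0# ≤ s
  0≤s = √-nonNeg 0≤2

  s*s≈2 : s * s ≈ 2#
  s*s≈2 = √-square 0≤2

  1≤s : 1# ≤ s
  1≤s with total 1# s
  ... | inj₁ 1≤s = 1≤s
  ... | inj₂ s≤1 = contradiction (begin
    2#      ≈⟨ s*s≈2 ⟨
    s * s   ≤⟨ *-monoʳ-≤ 0≤s s≤1 ⟩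
    s * 1#  ≈⟨ *-identityʳ s ⟩
    s       ≤⟨ s≤1 ⟩
    1#      ∎) 2≰1

  ⁻¹-inverse : ∀ {x} → 1# ≤ x → x * x ⁻¹ ≈ 1#
  ⁻¹-inverse 1≤x = ⁻¹-inverseʳ _ λ x≈0 →
    0≉1 (antisym 0≤1 (≤-trans 1≤x (≤-reflexive x≈0)))

  2s⁻¹≈s : 2# * s ⁻¹ ≈ s
  2s⁻¹≈s = begin-equality
    2# * s ⁻¹      ≈⟨ *-congʳ s*s≈2 ⟨
    s * s * s ⁻¹   ≈⟨ *-assoc s s (s ⁻¹) ⟩
    s * (s * s ⁻¹) ≈⟨ *-congˡ (⁻¹-inverse 1≤s) ⟩
    s * 1#         ≈⟨ *-identityʳ s ⟩
    s              ∎

  -- Since `2# * s ⁻¹ ≈ s`, four of the five terms equal `1# + s` at this point; the remaining one,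
  -- `2#`, is at most that because `1# ≤ s`.
  ratioBound-s : ratioBound s s ≤ 1# + s
  ratioBound-s = ⊔-lub (≤-reflexive first) (⊔-lub (≤-reflexive second)
    (⊔-lub ≤-refl (⊔-lub (+-monoʳ-≤ 1# 1≤s) (≤-reflexive (+-congˡ 2s⁻¹≈s)))))
    where
    first : s * (1# + s ⁻¹) ≈ 1# + s
    first = trans (solve 2 (λ x y → x :* (con 1 :+ y) := x :* y :+ x) refl s (s ⁻¹))
                  (+-congʳ (⁻¹-inverse 1≤s))

    second : 1# + s ⁻¹ + s ⁻¹ ≈ 1# + s
    second = trans (solve 1 (λ y → con 1 :+ y :+ y := con 1 :+ con 2 :* y) refl (s ⁻¹))
                   (+-congˡ 2s⁻¹≈s)

  1+s≤ratioBound : ∀ α β → 1# ≤ α → 1# ≤ β → 1# + s ≤ ratioBound α β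
  1+s≤ratioBound α β 1≤α 1≤β with total s β | total s α
  ... | inj₁ s≤β | _        = begin
    1# + s          ≤⟨ +-monoʳ-≤ 1# s≤β ⟩
    1# + β          ≤⟨ x≤x⊔y _ _ ⟩
    max (1# + β) _  ≤⟨ x≤y⊔x _ _ ⟩
    max _ _         ≤⟨ x≤y⊔x _ _ ⟩
    ratioBound α β  ∎
  ... | inj₂ _   | inj₂ α≤s = begin
    -- The claim `s ≤ 2# * α ⁻¹` is proved after multiplication by `α`, where it becomes
    -- `α * s ≤ s * s ≈ 2#`.
    1# + s               ≤⟨ +-monoʳ-≤ 1# (*-cancelˡ-≤ 1≤α αs≤α2α⁻¹) ⟩
    1# + 2# * α ⁻¹       ≤⟨ x≤y⊔x _ _ ⟩
    max 2# _             ≤⟨ x≤y⊔x _ _ ⟩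
    max (1# + β) _       ≤⟨ x≤y⊔x _ _ ⟩
    max _ _              ≤⟨ x≤y⊔x _ _ ⟩
    ratioBound α β       ∎
    where
    αs≤α2α⁻¹ : α * s ≤ α * (2# * α ⁻¹)
    αs≤α2α⁻¹ = begin
      α * s            ≤⟨ *-monoˡ-≤ 0≤s α≤s ⟩
      s * s            ≈⟨ s*s≈2 ⟩
      2#               ≈⟨ *-identityʳ 2# ⟨
      2# * 1#          ≈⟨ *-congˡ (⁻¹-inverse 1≤α) ⟨
      2# * (α * α ⁻¹)  ≈⟨ solve 3 (λ x y z → x :* (y :* z) := y :* (x :* z)) refl 2# α (α ⁻¹) ⟩
      α * (2# * α ⁻¹)  ∎
  ... | inj₂ β≤s | inj₁ s≤α = begin
    -- Here `s * β ⁻¹` is at least `1#` because `β ≤ s`; after factoring out `s`, replacing it by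
    -- the larger `α` gives the first term of the bound.
    1# + s           ≤⟨ +-monoˡ-≤ s (*-cancelˡ-≤ 1≤β β≤βsβ⁻¹) ⟩
    s * β ⁻¹ + s     ≈⟨ solve 2 (λ x y → x :* y :+ x := x :* (con 1 :+ y)) refl s (β ⁻¹) ⟩
    s * (1# + β ⁻¹)  ≤⟨ *-monoˡ-≤ (+-nonNeg 0≤1 0≤β⁻¹) s≤α ⟩
    α * (1# + β ⁻¹)  ≤⟨ x≤x⊔y _ _ ⟩
    ratioBound α β   ∎
    where
    0≤β⁻¹ : 0# ≤ β ⁻¹
    0≤β⁻¹ = *-cancelˡ-≤ 1≤β (begin
      β * 0#    ≈⟨ zeroʳ β ⟩
      0#        ≤⟨ 0≤1 ⟩
      1#        ≈⟨ ⁻¹-inverse 1≤β ⟨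
      β * β ⁻¹  ∎)

    β≤βsβ⁻¹ : β * 1# ≤ β * (s * β ⁻¹)
    β≤βsβ⁻¹ = begin
      β * 1#          ≈⟨ *-identityʳ β ⟩
      β               ≤⟨ β≤s ⟩
      s               ≈⟨ *-identityʳ s ⟨
      s * 1#          ≈⟨ *-congˡ (⁻¹-inverse 1≤β) ⟨
      s * (β * β ⁻¹)  ≈⟨ solve 3 (λ x y z → x :* (y :* z) := y :* (x :* z)) refl s β (β ⁻¹) ⟩
      β * (s * β ⁻¹)  ∎

  ratioBound-minimized : IsMinimizer ratioBound s s
  ratioBound-minimized = record
    { 1≤α     = 1≤s
    ; 1≤β     = 1≤s
    ; minimal = λ α β 1≤α 1≤β → ≤-trans ratioBound-s (1+s≤ratioBound α β 1≤α 1≤β)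
    }

-- Delays between jobs and completion times.

module Delays {c ℓ₁ ℓ₂ : Level} (R : EuclideanField c ℓ₁ ℓ₂)
              (I : Scheduling.Instance R) where

  open EuclideanField R
  open Scheduling R
  open Instance I
  open OrderedField R
  open Sum semiring using (sum; sum-remove; sum-cong-≋; sum-replicate-zero; ∑-distrib-+)
  open Solver commutativeSemiring
  open ≤-Reasoning poset

  spent : Task n → Fin n → Carrier
  spent τ i = if does (job τ ≟ i) then duration I τ else 0#

  -- The task that completes `j` still counts and later ones do not. The case `i ≡ j` is therefore
  -- the work on `j` up to its own completion, and a sum over all `i` needs no separate term for
  -- `j`.
  delay : List (Task n) → Fin n → Fin n → Carrier
  delay []      i j = 0#
  delay (τ ∷ L) i j = spent τ i + (if completes τ j then 0# else delay L i j)

  -- On the diagonal the own delay is counted twice, so a sum over all `i` and `j` doubles every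
  -- delay uniformly.
  pairDelay : Fin n → Fin n → List (Task n) → Carrier
  pairDelay i j L = delay L i j + delay L j i

  pairDelay-comm : ∀ i j L → pairDelay i j L ≈ pairDelay j i L
  pairDelay-comm i j L = +-comm (delay L i j) (delay L j i)

  duration-nonNeg : ∀ τ → 0# ≤ duration I τ
  duration-nonNeg (test j)     = 0≤t j
  duration-nonNeg (execute j)  = 0≤p j
  duration-nonNeg (untested j) = 0≤u j

  spent-nonNeg : ∀ τ i → 0# ≤ spent τ i
  spent-nonNeg τ i with does (job τ ≟ i)
  ... | true  = duration-nonNeg τ
  ... | false = ≤-refl

  delay-nonNeg : ∀ L i j → 0# ≤ delay L i j
  delay-nonNeg []      i j = ≤-refl
  delay-nonNeg (τ ∷ L) i j with completes τ j
  ... | true  = +-nonNeg (spent-nonNeg τ i) ≤-refl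
  ... | false = +-nonNeg (spent-nonNeg τ i) (delay-nonNeg L i j)

  spent-own : ∀ {τ i} → job τ ≡ i → spent τ i ≈ duration I τ
  spent-own {τ} {i} eq rewrite dec-true (job τ ≟ i) eq = refl

  spent-other : ∀ {τ i} → job τ ≢ i → spent τ i ≈ 0#
  spent-other {τ} {i} neq rewrite dec-false (job τ ≟ i) neq = refl

  completes-other : ∀ {n} {τ : Task n} {j} → job τ ≢ j → completes τ j ≡ false
  completes-other {τ = test _}     _   = ≡.refl
  completes-other {τ = execute i}  neq = dec-false (i ≟ _) neq
  completes-other {τ = untested i} neq = dec-false (i ≟ _) neq

  completes-execute : ∀ {n} (i : Fin n) → completes (execute i) i ≡ true
  completes-execute i = dec-true (i ≟ i) ≡.refl

  completes-untested : ∀ {n} (i : Fin n) → completes (untested i) i ≡ true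
  completes-untested i = dec-true (i ≟ i) ≡.refl

  completes⇒job : ∀ {n} {τ : Task n} {j} → completes τ j ≡ true → job τ ≡ j
  completes⇒job {τ = τ} {j} eq with job τ ≟ j
  ... | yes eq′ = eq′
  ... | no neq with () ← ≡.trans (≡.sym eq) (completes-other {τ = τ} neq)

  delay-completes : ∀ {τ L i j} → completes τ j ≡ true → delay (τ ∷ L) i j ≈ spent τ i
  delay-completes eq rewrite eq = +-identityʳ _

  delay-continues : ∀ {τ L i j} → completes τ j ≡ false →
                    delay (τ ∷ L) i j ≈ spent τ i + delay L i j
  delay-continues eq rewrite eq = refl

  sum-spent : ∀ τ → sum (spent τ) ≈ duration I τ
  sum-spent τ = sum-indicator (job τ) (duration I τ)
    where
    sum-indicator : ∀ {m} (k : Fin m) d →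
                    sum (λ i → if does (k ≟ i) then d else 0#) ≈ d
    sum-indicator {suc m} k d = begin-equality
      sum f                              ≈⟨ sum-remove {i = k} f ⟩
      f k + sum (λ i → f (punchIn k i))  ≈⟨ +-cong fk≈d (sum-cong-≋ others) ⟩
      d + sum {m} (λ _ → 0#)             ≈⟨ +-congˡ (sum-replicate-zero m) ⟩
      d + 0#                             ≈⟨ +-identityʳ d ⟩
      d                                  ∎
      where
      f : Fin (suc m) → Carrier
      f i = if does (k ≟ i) then d else 0#

      fk≈d : f k ≈ d
      fk≈d rewrite dec-true (k ≟ k) ≡.refl = refl

      others : ∀ i → f (punchIn k i) ≈ 0#
      others i rewrite dec-false (k ≟ punchIn k i) (≢-sym (punchInᵢ≢i k i)) = refl

  Executes : Fin n → List (Task n) → Set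
  Executes j = Any (λ τ → completes τ j ≡ true)

  -- Each task up to the completion of `j` advances the clock by its duration, and `sum-spent`
  -- distributes this duration over the jobs. `Executes j L` excludes the default value `0#` of
  -- `completionFrom` on the empty list.
  completion≈∑delay : ∀ now L j → Executes j L →
    completionFrom I now (map run L) j ≈ now + sum (λ i → delay L i j)
  completion≈∑delay now (τ ∷ L) j e with completes τ j in done
  ... | true  = +-congˡ (sym (trans (sum-cong-≋ λ i → +-identityʳ (spent τ i)) (sum-spent τ)))
  ... | false with e
  ...   | here done′ with () ← ≡.trans (≡.sym done) done′
  ...   | there e′ = begin-equality
    completionFrom I (now + duration I τ) (map run L) j          ≈⟨ completion≈∑delay _ L j e′ ⟩
    now + duration I τ + sum (λ i → delay L i j)                 ≈⟨ +-assoc _ _ _ ⟩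
    now + (duration I τ + sum (λ i → delay L i j))               ≈⟨ +-congˡ (+-congʳ (sum-spent τ)) ⟨
    now + (sum (spent τ) + sum (λ i → delay L i j))              ≈⟨ +-congˡ (∑-distrib-+ (spent τ) (λ i → delay L i j)) ⟨
    now + sum (λ i → spent τ i + delay L i j)                    ∎

  -- Two starting times are carried through the induction because each idle period puts the clock of
  -- `s` further ahead.
  withoutIdle : ∀ {now now′} s j → now ≤ now′ → Executes j (tasks s) →
    completionFrom I now (map run (tasks s)) j ≤ completionFrom I now′ s j
  withoutIdle (idle d 0≤d ∷ s) j le e = withoutIdle s j (≤-trans le (x≤x+y 0≤d)) e
  withoutIdle (run τ ∷ s)      j le e with completes τ j in done
  ... | true  = +-monoˡ-≤ _ le
  ... | false with e
  ...   | here done′ with () ← ≡.trans (≡.sym done) done′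
  ...   | there e′ = withoutIdle s j (+-monoˡ-≤ _ le) e′

  feasible⇒executes : ∀ {s} → Feasible s → ∀ j → Executes j (tasks s)
  feasible⇒executes {s} feas j = [ by (completes-untested j) (here ≡.refl)
                                 , by (completes-execute j) (there (here ≡.refl)) ]′ (feas j)
    where
    by : ∀ {τ A} → completes τ j ≡ true → τ ∈ A → tasksOf j s ≡ A → Executes j (tasks s)
    by done τ∈A eq =
      lose (proj₁ (∈-filter⁻ (λ σ → job σ ≟ j) (≡.subst (_ ∈_) (≡.sym eq) τ∈A))) done

  -- A discarded task neither belongs to `i` nor completes `j`, so it adds nothing and does not end
  -- the count. This reduces delays to runs on one or two jobs.
  delay-filter : ∀ {q} {P : Pred (Fin n) q} (P? : Decidable P) {i j} → P i → P j →
                 ∀ L → delay (filter (P? ∘ job) L) i j ≈ delay L i j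
  delay-filter P? Pi Pj [] = refl
  delay-filter {P = P} P? {i} {j} Pi Pj (τ ∷ L) with P? (job τ)
  ... | yes _ with completes τ j
  ...   | true  = refl
  ...   | false = +-congˡ (delay-filter P? Pi Pj L)
  delay-filter {P = P} P? {i} {j} Pi Pj (τ ∷ L) | no ¬Pτ = begin-equality
    delay (filter (P? ∘ job) L) i j  ≈⟨ delay-filter P? Pi Pj L ⟩
    delay L i j                      ≈⟨ +-identityˡ _ ⟨
    0# + delay L i j                 ≈⟨ +-congʳ (spent-other {τ} λ eq → ¬Pτ (≡.subst P (≡.sym eq) Pi)) ⟨
    spent τ i + delay L i j          ≈⟨ delay-continues {τ} {L}
      (completes-other {τ = τ} λ eq → ¬Pτ (≡.subst P (≡.sym eq) Pj)) ⟨
    delay (τ ∷ L) i j                ∎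

  delay-untested : ∀ i → delay (untested i ∷ []) i i ≈ u i
  delay-untested i = trans
    (delay-completes {untested i} {[]} (completes-untested i))
    (spent-own {untested i} ≡.refl)

  delay-tested : ∀ i → delay (test i ∷ execute i ∷ []) i i ≈ t i + p i
  delay-tested i = +-cong (spent-own {test i} ≡.refl)
    (trans (delay-completes {execute i} {[]} (completes-execute i)) (spent-own {execute i} ≡.refl))

  delay-none : ∀ {L i} j → All (λ τ → job τ ≢ i) L → delay L i j ≈ 0#
  delay-none j [] = refl
  delay-none {τ ∷ L} j (neq ∷ neqs) with completes τ j
  ... | true  = trans (+-congʳ (spent-other {τ} neq)) (+-identityʳ 0#)
  ... | false = trans (+-cong (spent-other {τ} neq) (delay-none {L} j neqs)) (+-identityʳ 0#)

  pairDelay-test : ∀ {i j} → i ≢ j → ∀ L → pairDelay i j (test i ∷ L) ≈ t i + pairDelay i j L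
  pairDelay-test {i} {j} i≢j L = begin-equality
    (spent (test i) i + delay L i j) + (spent (test i) j + delay L j i)
      ≈⟨ +-cong (+-congʳ (spent-own {test i} ≡.refl)) (+-congʳ (spent-other {test i} i≢j)) ⟩
    (t i + delay L i j) + (0# + delay L j i)
      ≈⟨ solve 3 (λ x y z → (x :+ y) :+ (con 0 :+ z) := x :+ (y :+ z)) refl _ _ _ ⟩
    t i + pairDelay i j L ∎

  -- The count of `j` before `i` stops at `τ`, which is not a task of `j`; the count of `i` before
  -- `j` goes on, but meets no further task of `i`. Only `τ` itself contributes.
  pairDelay-finish : ∀ {τ i j} → i ≢ j → completes τ i ≡ true →
                     ∀ {L} → All (λ σ → job σ ≢ i) L → pairDelay i j (τ ∷ L) ≈ duration I τ
  pairDelay-finish {τ} {i} {j} i≢j done {L} others = begin-equality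
    delay (τ ∷ L) i j + delay (τ ∷ L) j i
      ≈⟨ +-cong (delay-continues {τ} {L} (completes-other {τ = τ} τ≢j))
                (trans (delay-completes {τ} {L} done) (spent-other {τ} τ≢j)) ⟩
    spent τ i + delay L i j + 0#
      ≈⟨ +-congʳ (+-cong (spent-own {τ} τ≡i) (delay-none {L} j others)) ⟩
    duration I τ + 0# + 0#
      ≈⟨ solve 1 (λ x → x :+ con 0 :+ con 0 := x) refl _ ⟩
    duration I τ ∎
    where
    τ≡i : job τ ≡ i
    τ≡i = completes⇒job {τ = τ} done

    τ≢j : job τ ≢ j
    τ≢j eq = i≢j (≡.trans (≡.sym τ≡i) eq)

  -- Up to the first completion both counts of the same job agree. If `i` is completed first, the
  -- count of `i` before `j` merely continues; otherwise the roles are exchanged. This supplies the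
  -- lower bound for the optimum.
  delay-total : ∀ L {i j} → i ≢ j → delay L i i ≤ delay L i j ⊎ delay L j j ≤ delay L j i
  delay-total []      i≢j = inj₁ ≤-refl
  delay-total (τ ∷ L) {i} {j} i≢j with completes τ i in doneᵢ | completes τ j in doneⱼ
  ... | true  | true  = inj₁ ≤-refl
  ... | true  | false = inj₁ (+-monoʳ-≤ _ (delay-nonNeg L i j))
  ... | false | true  = inj₂ (+-monoʳ-≤ _ (delay-nonNeg L j i))
  ... | false | false = Sum⊎.map (+-monoʳ-≤ _) (+-monoʳ-≤ _) (delay-total L i≢j)

-- Runs of SORT and their projections onto few jobs.

module Races {c ℓ₁ ℓ₂ : Level} (R : EuclideanField c ℓ₁ ℓ₂) (α β : EuclideanField.Carrier R)
             (I : Scheduling.Instance R) where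

  open EuclideanField R
  open Scheduling R
  open Instance I

  w : Task n → Carrier
  w = weight α β I

  next : Task n → List (Task n)
  next = followUp α β I

  init : Fin n → Task n
  init = initialTask α β I

  -- SortRun on the bare list of tasks: SORT never idles, and runs without
  -- idle time can be projected onto a subset of the jobs.
  data Order : List (Task n) → List (Task n) → Set (c ⊔ ℓ₂) where
    stop    : Order [] []
    extract : ∀ {Q Q′ τ L} → Q ↭ τ ∷ Q′ → All (λ σ → w τ ≤ w σ) Q′ →
              Order (next τ ++ Q′) L → Order Q (τ ∷ L)

  sortRun⇒order : ∀ {Q s} → SortRun α β I Q s → Order Q (tasks s)
  sortRun⇒order stop              = stop
  sortRun⇒order (extract e le r) = extract e le (sortRun⇒order r)

  sortRun-busy : ∀ {Q s} → SortRun α β I Q s → s ≡ map run (tasks s)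
  sortRun-busy stop            = ≡.refl
  sortRun-busy (extract _ _ r) = ≡.cong (_ ∷_) (sortRun-busy r)

  order-resp-↭ : ∀ {Q Q′ L} → Q ↭ Q′ → Order Q L → Order Q′ L
  order-resp-↭ e stop rewrite ↭-empty-inv (↭-sym e) = stop
  order-resp-↭ e (extract e′ le r) = extract (↭-trans (↭-sym e) e′) le r

  next-job : ∀ {q} {P : Pred (Fin n) q} τ → P (job τ) → All (P ∘ job) (next τ)
  next-job (test _)     Pj = Pj ∷ []
  next-job (execute _)  Pj = []
  next-job (untested _) Pj = []

  order-jobs : ∀ {q} {P : Pred (Fin n) q} {Q L} → All (P ∘ job) Q → Order Q L → All (P ∘ job) L
  order-jobs _  stop             = []
  order-jobs {P = P} all (extract {τ = τ} e _ r) with Pτ ∷ rest ← All-resp-↭ e all =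
    Pτ ∷ order-jobs {P = P} (All.++⁺ (next-job {P = P} τ Pτ) rest) r

  -- A task and its follow-up belong to the same job. If the extracted task is kept, so is its
  -- follow-up, and its weight is still minimal in the smaller queue; if it is dropped, both vanish
  -- and the filtered queue is unchanged up to order.
  order-filter : ∀ {q} {P : Pred (Fin n) q} (P? : Decidable P) {Q L} →
                 Order Q L → Order (filter (P? ∘ job) Q) (filter (P? ∘ job) L)
  order-filter P? stop = stop
  order-filter {P = P} P? {Q} (extract {Q′ = Q′} {τ = τ} {L = L} e le r)
    with P? (job τ) | order-filter P? r
  ... | yes Pτ | r′ = extract
    (↭-trans (filter-↭ (P? ∘ job) e) (↭-reflexive (filter-accept (P? ∘ job) Pτ)))
    (All.filter⁺ (P? ∘ job) le)
    (≡.subst (λ A → Order A _)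
      (≡.trans (filter-++ (P? ∘ job) (next τ) Q′)
               (≡.cong (_++ _) (filter-all (P? ∘ job) (next-job {P = P} τ Pτ)))) r′)
  ... | no ¬Pτ | r′ = order-resp-↭
    (↭-sym (↭-trans (filter-↭ (P? ∘ job) e) (↭-reflexive (filter-reject (P? ∘ job) ¬Pτ))))
    (≡.subst (λ A → Order A _)
      (≡.trans (filter-++ (P? ∘ job) (next τ) Q′)
               (≡.cong (_++ _) (filter-none (P? ∘ job) (next-job {P = ¬_ ∘ P} τ ¬Pτ)))) r′)

  initial-job : ∀ j → job (init j) ≡ j
  initial-job j with does (α * t j ≤? u j)
  ... | true  = ≡.refl
  ... | false = ≡.refl

  initial-filter : ∀ {q} {P : Pred (Fin n) q} (P? : Decidable P) xs →
                   filter (P? ∘ job) (map init xs) ≡ map init (filter P? xs)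
  initial-filter P? []       = ≡.refl
  initial-filter P? (x ∷ xs) rewrite initial-job x with does (P? x)
  ... | true  = ≡.cong (_ ∷_) (initial-filter P? xs)
  ... | false = initial-filter P? xs

  order-project : ∀ {q} {P : Pred (Fin n) q} (P? : Decidable P) {xs L} → Unique xs →
                  All P xs → (∀ {k} → P k → k ∈ xs) → Order (map init (allFin n)) L →
                  Order (map init xs) (filter (P? ∘ job) L)
  order-project P? {xs} xs! allP P⇒∈ r =
    order-resp-↭ (↭-trans (↭-reflexive (initial-filter P? (allFin n))) (map⁺ init selected))
                 (order-filter P? r)
    where
    selected : filter P? (allFin n) ↭ xs
    -- Two duplicate-free lists with the same elements are permutations of each other.
    selected = ∼bag⇒↭ (unique∧set⇒bag (Unique.filter⁺ P? (Unique.allFin⁺ n)) xs!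
      (mk⇔ (λ k∈ → P⇒∈ (proj₂ (∈-filter⁻ P? {xs = allFin n} k∈)))
           (λ k∈ → ∈-filter⁺ P? (∈-allFin _) (All.lookup allP k∈))))

  order₀ : ∀ {L} → Order [] L → L ≡ []
  order₀ stop            = ≡.refl
  order₀ (extract e _ _) with () ← ↭-empty-inv (↭-sym e)

  order₁ : ∀ {a L} → Order (a ∷ []) L → ∃ λ L′ → L ≡ a ∷ L′ × Order (next a) L′
  order₁ (extract e _ r) with ≡.refl ← ↭-singleton-inv (↭-sym e) =
    _ , ≡.refl , ≡.subst (λ A → Order A _) (++-identityʳ _) r

  First : Task n → Task n → List (Task n) → Set (c ⊔ ℓ₂)
  First a b L = ∃ λ L′ → L ≡ a ∷ L′ × w a ≤ w b × Order (next a ++ b ∷ []) L′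

  order₂ : ∀ {a b L} → Order (a ∷ b ∷ []) L → First a b L ⊎ First b a L
  order₂ {a} {b} (extract e le r) with ∈-resp-↭ (↭-sym e) (here ≡.refl)
  ... | here ≡.refl
    with ≡.refl ← ↭-singleton-inv (↭-sym (drop-∷ e)) | wa≤wb ∷ [] ← le =
    inj₁ (_ , ≡.refl , wa≤wb , r)
  ... | there (here ≡.refl)
    with ≡.refl ← ↭-singleton-inv (↭-sym (drop-∷ (↭-trans (swap b a ↭-refl) e)))
       | wb≤wa ∷ [] ← le =
    inj₂ (_ , ≡.refl , wb≤wa , r)

-- Bounds for single jobs and for pairs, with both parameters equal to √2.

module SortAnalysis {c ℓ₁ ℓ₂ : Level} (R : EuclideanField c ℓ₁ ℓ₂)
                    (I : Scheduling.Instance R) where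

  open EuclideanField R
  open Scheduling R
  open Instance I
  open OrderedField R
  open SquareRootOf2 R
  open Delays R I
  open Races R s s I
  open Sum semiring using (sum; sum-cong-≋; ∑-distrib-+; ∑-comm; *-distribˡ-sum)
  open Solver commutativeSemiring
  open ≤-Reasoning poset

  -- The two amounts of work that a feasible schedule can spend on `i`. The optimum may choose
  -- either one whatever SORT does, so each bound is proved against both.
  WorksFor : Fin n → Carrier → Set ℓ₁
  WorksFor i x = x ≈ u i ⊎ x ≈ t i + p i

  -- The two conditions overlap at equality: the negated comparison is weakened to `≤`, the form in
  -- which the estimates use it.
  Tested Untested : Fin n → Set ℓ₂
  Tested i   = s * t i ≤ u i
  Untested i = u i ≤ s * t i

  initial : ∀ i → Tested i × init i ≡ test i ⊎ Untested i × init i ≡ untested i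
  initial i with s * t i ≤? u i
  ... | yes st≤u = inj₁ (st≤u , ≡.refl)
  ... | no  st≰u = inj₂ ([ id , (λ st≤u → contradiction st≤u st≰u) ]′ (total (u i) (s * t i)) , ≡.refl)

  x≤sx : ∀ {x} → 0# ≤ x → x ≤ s * x
  x≤sx 0≤x = ≤-trans (≤-reflexive (sym (*-identityˡ _))) (*-monoˡ-≤ 0≤x 1≤s)

  s-cancel : ∀ {x y} → s * x ≤ s * y → x ≤ y
  s-cancel = *-cancelˡ-≤ 1≤s

  sx≤y⇒x≤y : ∀ {x y} → 0# ≤ x → s * x ≤ y → x ≤ y
  sx≤y⇒x≤y 0≤x = ≤-trans (x≤sx 0≤x)

  x+sx≈[1+s]x : ∀ x → x + s * x ≈ (1# + s) * x
  x+sx≈[1+s]x x = solve 2 (λ s x → x :+ s :* x := (con 1 :+ s) :* x) refl s x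

  sx≤[1+s]x : ∀ {x} → 0# ≤ x → s * x ≤ (1# + s) * x
  sx≤[1+s]x 0≤x = ≤-trans (x≤y+x 0≤x) (≤-reflexive (x+sx≈[1+s]x _))

  x≤w∧y≤sw⇒x+y≤[1+s]w : ∀ {x y w} → x ≤ w → y ≤ s * w → x + y ≤ (1# + s) * w
  x≤w∧y≤sw⇒x+y≤[1+s]w x≤w y≤sw = ≤-trans (+-mono-≤ x≤w y≤sw) (≤-reflexive (x+sx≈[1+s]x _))

  -- sx ≤ y and sz ≤ y give s(x + z) ≤ 2y = s(sy).
  sx≤y∧sz≤y⇒x+z≤sy : ∀ {x y z} → s * x ≤ y → s * z ≤ y → x + z ≤ s * y
  sx≤y∧sz≤y⇒x+z≤sy {x} {y} {z} sx≤y sz≤y = s-cancel (begin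
    s * (x + z)    ≈⟨ distribˡ s x z ⟩
    s * x + s * z  ≤⟨ +-mono-≤ sx≤y sz≤y ⟩
    y + y          ≈⟨ solve 1 (λ y → y :+ y := con 2 :* y) refl y ⟩
    2# * y         ≈⟨ *-congʳ s*s≈2 ⟨
    s * s * y      ≈⟨ *-assoc s s y ⟩
    s * (s * y)    ∎)

  works-nonNeg : ∀ {i x} → WorksFor i x → 0# ≤ x
  works-nonNeg {i} (inj₁ eq) = ≤-trans (0≤u i) (≤-reflexive (sym eq))
  works-nonNeg {i} (inj₂ eq) = ≤-trans (+-nonNeg (0≤t i) (0≤p i)) (≤-reflexive (sym eq))

  p≤work : ∀ {i x} → WorksFor i x → p i ≤ x
  p≤work {i} (inj₁ eq) = ≤-trans (p≤u i) (≤-reflexive (sym eq))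
  p≤work {i} (inj₂ eq) = ≤-trans (x≤y+x (0≤t i)) (≤-reflexive (sym eq))

  t≤work : ∀ {i x} → Tested i → WorksFor i x → t i ≤ x
  t≤work {i} st≤u (inj₁ eq) = ≤-trans (sx≤y⇒x≤y (0≤t i) st≤u) (≤-reflexive (sym eq))
  t≤work {i} _    (inj₂ eq) = ≤-trans (x≤x+y (0≤p i)) (≤-reflexive (sym eq))

  u≤s*work : ∀ {i x} → Untested i → WorksFor i x → u i ≤ s * x
  u≤s*work {i} u≤st (inj₁ eq) = ≤-trans (x≤sx (0≤u i)) (≤-reflexive (*-congˡ (sym eq)))
  u≤s*work {i} u≤st (inj₂ eq) =
    ≤-trans u≤st (*-monoʳ-≤ 0≤s (≤-trans (x≤x+y (0≤p i)) (≤-reflexive (sym eq))))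

  -- This lets a job that runs first be charged to the other job: its weight is at most the initial
  -- weight of the other, hence at most `s` times the work on the other.
  initial-weight≤s*work : ∀ {i x} → WorksFor i x → w (init i) ≤ s * x
  initial-weight≤s*work {i} works with initial i
  ... | inj₁ (tested , eq)   rewrite eq = *-monoʳ-≤ 0≤s (t≤work tested works)
  ... | inj₂ (untestedᵢ , eq) rewrite eq = u≤s*work untestedᵢ works

  -- Here `x` stands for the test of the other job. Against `u i`, both `t i` and `x` are at most
  -- `u i` divided by `s`, so together at most `s * u i`, while `p i ≤ u i`. Against `t i + p i`,
  -- the extra `x` is at most `p i`.
  t+x+p≤ : ∀ {i x y} → Tested i → 0# ≤ x → s * x ≤ p i → WorksFor i y →
           t i + (x + p i) ≤ (1# + s) * y
  t+x+p≤ {i} {x} {y} tested 0≤x sx≤p (inj₁ eq) = begin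
    t i + (x + p i)  ≈⟨ solve 3 (λ t x p → t :+ (x :+ p) := p :+ (t :+ x)) refl _ _ _ ⟩
    p i + (t i + x)  ≤⟨ x≤w∧y≤sw⇒x+y≤[1+s]w (p≤u i)
                          (sx≤y∧sz≤y⇒x+z≤sy tested (≤-trans sx≤p (p≤u i))) ⟩
    (1# + s) * u i   ≈⟨ *-congˡ eq ⟨
    (1# + s) * y     ∎
  t+x+p≤ {i} {x} {y} tested 0≤x sx≤p (inj₂ eq) = begin
    t i + (x + p i)  ≈⟨ solve 3 (λ t x p → t :+ (x :+ p) := x :+ (t :+ p)) refl _ _ _ ⟩
    x + (t i + p i)  ≤⟨ x≤w∧y≤sw⇒x+y≤[1+s]w
                          (≤-trans (sx≤y⇒x≤y 0≤x sx≤p) (p≤work {i} (inj₂ eq)))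
                          (≤-trans (≤-reflexive (sym eq)) (x≤sx (works-nonNeg {i} (inj₂ eq)))) ⟩
    (1# + s) * y     ∎

  t+t+p≤ : ∀ {i y} → Tested i → WorksFor i y → t i + (t i + p i) ≤ (1# + s) * y
  t+t+p≤ {i} {y} tested (inj₁ eq) = begin
    t i + (t i + p i)  ≈⟨ solve 2 (λ t p → t :+ (t :+ p) := p :+ (t :+ t)) refl _ _ ⟩
    p i + (t i + t i)  ≤⟨ x≤w∧y≤sw⇒x+y≤[1+s]w (p≤u i) (sx≤y∧sz≤y⇒x+z≤sy tested tested) ⟩
    (1# + s) * u i     ≈⟨ *-congˡ eq ⟨
    (1# + s) * y       ∎
  t+t+p≤ {i} {y} tested (inj₂ eq) =
    x≤w∧y≤sw⇒x+y≤[1+s]w (t≤work tested (inj₂ eq))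
      (≤-trans (≤-reflexive (sym eq)) (x≤sx (works-nonNeg {i} (inj₂ eq))))

  t+p≤ : ∀ {i y} → Tested i → WorksFor i y → t i + p i ≤ (1# + s) * y
  t+p≤ {i} tested works = ≤-trans (x≤y+x (0≤t i)) (t+t+p≤ tested works)

  -- The work `y` may be that on either job, since it is not known which of the two the optimum
  -- completes first.
  Bounded : Fin n → Fin n → Carrier → Set (c ⊔ ℓ₁ ⊔ ℓ₂)
  Bounded i j x = ∀ {y} → WorksFor i y ⊎ WorksFor j y → x ≤ (1# + s) * y

  bounded-swap : ∀ {i j x x′} → x′ ≈ x → Bounded i j x → Bounded j i x′
  bounded-swap eq b works = ≤-trans (≤-reflexive eq) (b (Sum⊎.swap works))

  finish : ∀ {i j τ Q L} → i ≢ j → completes τ i ≡ true → All (λ σ → job σ ≡ j) Q →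
           Order Q L → pairDelay i j (τ ∷ L) ≈ duration I τ
  finish {i} {j} {τ} i≢j done onlyj r = pairDelay-finish {τ} i≢j done
    (All.map (λ eq eq′ → i≢j (≡.trans (≡.sym eq′) eq)) (order-jobs {P = _≡ j} onlyj r))

  pairDelay-test′ : ∀ {i j} → i ≢ j → ∀ L → pairDelay i j (test j ∷ L) ≈ t j + pairDelay i j L
  pairDelay-test′ {i} {j} i≢j L = trans (pairDelay-comm i j (test j ∷ L))
    (trans (pairDelay-test (≢-sym i≢j) L) (+-congˡ (pairDelay-comm j i L)))

  finish′ : ∀ {i j τ Q L} → i ≢ j → completes τ j ≡ true → All (λ σ → job σ ≡ i) Q →
            Order Q L → pairDelay i j (τ ∷ L) ≈ duration I τ
  finish′ {i} {j} {τ} {L = L} i≢j done onlyi r =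
    trans (pairDelay-comm i j (τ ∷ L)) (finish {τ = τ} (≢-sym i≢j) done onlyi r)

  -- Both tests are followed by an execution of length `q`, the smaller of `p i` and `p j`. Against
  -- `i`, `q` is replaced by `p i` and `t j` is the extra test; against `j`, `q` is replaced by
  -- `p j` and `t i` by `t j`, which is no smaller by the order of the tests.
  bothTested : ∀ {i j q} → Tested i → Tested j → s * t i ≤ s * t j → s * t j ≤ p i →
               q ≤ p i → q ≤ p j → Bounded i j (t i + (t j + q))
  bothTested {i} {j} {q} testedᵢ testedⱼ stᵢ≤stⱼ stⱼ≤pᵢ q≤pᵢ q≤pⱼ {y} (inj₁ works) = begin
    t i + (t j + q)    ≤⟨ +-monoʳ-≤ _ (+-monoʳ-≤ _ q≤pᵢ) ⟩
    t i + (t j + p i)  ≤⟨ t+x+p≤ testedᵢ (0≤t j) stⱼ≤pᵢ works ⟩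
    (1# + s) * y       ∎
  bothTested {i} {j} {q} testedᵢ testedⱼ stᵢ≤stⱼ stⱼ≤pᵢ q≤pᵢ q≤pⱼ {y} (inj₂ works) = begin
    t i + (t j + q)    ≤⟨ +-mono-≤ (s-cancel stᵢ≤stⱼ) (+-monoʳ-≤ _ q≤pⱼ) ⟩
    t j + (t j + p j)  ≤⟨ t+t+p≤ testedⱼ works ⟩
    (1# + s) * y       ∎

  -- The hypothesis `s * t i ≤ w (init j)` records that the test of `i` was extracted first. The
  -- cases differ in the task that first completes a job: `execute i`, `untested j`, or one of the
  -- executions after both tests.
  testedTail : ∀ {i j L} → i ≢ j → Tested i → s * t i ≤ w (init j) →
               Order (execute i ∷ init j ∷ []) L → Bounded i j (t i + pairDelay i j L)
  testedTail {i} {j} i≢j testedᵢ stᵢ≤wⱼ r works with order₂ r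
  -- The delay is `t i + p i`. For a work `y` on `j`, both `s * t i` and `p i` are at most
  -- `w (init j) ≤ s * y`, and cancelling `s` leaves `t i ≤ y`.
  ... | inj₁ (L , ≡.refl , pᵢ≤wⱼ , r′) =
    ≤-trans (≤-reflexive (+-congˡ (finish {τ = execute i} i≢j
               (completes-execute i) (initial-job j ∷ []) r′)))
      ([ t+p≤ testedᵢ
       , (λ worksⱼ → let wⱼ≤ = initial-weight≤s*work worksⱼ in
           x≤w∧y≤sw⇒x+y≤[1+s]w (s-cancel (≤-trans stᵢ≤wⱼ wⱼ≤)) (≤-trans pᵢ≤wⱼ wⱼ≤))
       ]′ works)
  ... | inj₂ (L , ≡.refl , wⱼ≤pᵢ , r′) with initial j
  -- The delay is `t i + u j`. Against `i`, `u j` is at most `p i`; against `j`, cancelling `s`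
  -- again bounds `t i` by the work.
  ...   | inj₂ (untestedⱼ , eq) rewrite eq =
    ≤-trans (≤-reflexive (+-congˡ (finish′ {τ = untested j} i≢j
               (completes-untested j) (≡.refl ∷ []) r′)))
      ([ (λ worksᵢ → ≤-trans (+-monoʳ-≤ _ wⱼ≤pᵢ) (t+p≤ testedᵢ worksᵢ))
       , (λ worksⱼ → let uⱼ≤ = u≤s*work untestedⱼ worksⱼ in
           x≤w∧y≤sw⇒x+y≤[1+s]w (s-cancel (≤-trans stᵢ≤wⱼ uⱼ≤)) uⱼ≤)
       ]′ works)
  ...   | inj₁ (testedⱼ , eq) rewrite eq with order₂ r′
  ...     | inj₁ (L′ , ≡.refl , pⱼ≤pᵢ , r″) =
    ≤-trans (≤-reflexive (+-congˡ (trans (pairDelay-test′ i≢j (execute j ∷ L′)) (+-congˡ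
               (finish′ {τ = execute j} i≢j (completes-execute j) (≡.refl ∷ []) r″)))))
      (bothTested testedᵢ testedⱼ stᵢ≤wⱼ wⱼ≤pᵢ pⱼ≤pᵢ ≤-refl works)
  ...     | inj₂ (L′ , ≡.refl , pᵢ≤pⱼ , r″) =
    ≤-trans (≤-reflexive (+-congˡ (trans (pairDelay-test′ i≢j (execute i ∷ L′)) (+-congˡ
               (finish {τ = execute i} i≢j (completes-execute i) (≡.refl ∷ []) r″)))))
      (bothTested testedᵢ testedⱼ stᵢ≤wⱼ wⱼ≤pᵢ ≤-refl pᵢ≤pⱼ works)

  first-bounded : ∀ {i j L} → i ≢ j → First (init i) (init j) L → Bounded i j (pairDelay i j L)
  first-bounded {i} {j} i≢j (L , ≡.refl , wᵢ≤wⱼ , r) {y} works with initial i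
  ... | inj₁ (testedᵢ , eq) rewrite eq =
    ≤-trans (≤-reflexive (pairDelay-test i≢j L)) (testedTail i≢j testedᵢ wᵢ≤wⱼ r works)
  -- Nothing of `j` precedes and nothing of `i` follows, so the pair is delayed by `u i` only.
  ... | inj₂ (untestedᵢ , eq) rewrite eq = begin
    pairDelay i j (untested i ∷ L)
      ≈⟨ finish {τ = untested i} i≢j (completes-untested i) (initial-job j ∷ []) r ⟩
    u i
      ≤⟨ [ u≤s*work untestedᵢ , (λ worksⱼ → ≤-trans wᵢ≤wⱼ (initial-weight≤s*work worksⱼ)) ]′ works ⟩
    s * y
      ≤⟨ sx≤[1+s]x ([ works-nonNeg , works-nonNeg ]′ works) ⟩
    (1# + s) * y
      ∎

  pair-bounded : ∀ {i j L} → i ≢ j → Order (init i ∷ init j ∷ []) L → Bounded i j (pairDelay i j L)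
  pair-bounded {i} {j} {L} i≢j r with order₂ r
  ... | inj₁ first = first-bounded i≢j first
  ... | inj₂ first = bounded-swap (pairDelay-comm i j L) (first-bounded (≢-sym i≢j) first)

  -- From pairs of jobs to the cost of schedules.

  single : ∀ {i L} → Order (init i ∷ []) L →
           Untested i × L ≡ untested i ∷ [] ⊎ Tested i × L ≡ test i ∷ execute i ∷ []
  single {i} r with initial i
  ... | inj₁ (testedᵢ , eq) rewrite eq
    with _ , ≡.refl , r′ ← order₁ r
    with _ , ≡.refl , r″ ← order₁ r′
    with ≡.refl ← order₀ r″ = inj₂ (testedᵢ , ≡.refl)
  ... | inj₂ (untestedᵢ , eq) rewrite eq
    with _ , ≡.refl , r′ ← order₁ r
    with ≡.refl ← order₀ r′ = inj₁ (untestedᵢ , ≡.refl)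

  ownDelay : ∀ {i A} s → tasksOf i s ≡ A → delay (tasks s) i i ≈ delay A i i
  ownDelay {i} s eq = trans (sym (delay-filter (_≟ i) ≡.refl ≡.refl (tasks s)))
                            (reflexive (≡.cong (λ A → delay A i i) eq))

  feasible-works : ∀ {s} → Feasible s → ∀ i → WorksFor i (delay (tasks s) i i)
  feasible-works {s} feas i = Sum⊎.map (λ eq → trans (ownDelay s eq) (delay-untested i))
                                       (λ eq → trans (ownDelay s eq) (delay-tested i)) (feas i)

  totalDelay : List (Task n) → Carrier
  totalDelay L = sum λ j → sum λ i → delay L i j

  ∑pairDelay : ∀ L → (sum λ j → sum λ i → pairDelay i j L) ≈ totalDelay L + totalDelay L
  ∑pairDelay L = begin-equality
    (sum λ j → sum λ i → pairDelay i j L)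
      ≈⟨ sum-cong-≋ (λ j → ∑-distrib-+ (λ i → delay L i j) (λ i → delay L j i)) ⟩
    (sum λ j → (sum λ i → delay L i j) + (sum λ i → delay L j i))
      ≈⟨ ∑-distrib-+ (λ j → sum λ i → delay L i j) (λ j → sum λ i → delay L j i) ⟩
    totalDelay L + (sum λ j → sum λ i → delay L j i)
      ≈⟨ +-congˡ (∑-comm (delay L)) ⟩
    totalDelay L + totalDelay L ∎

  sum-mono-≤ : ∀ {m} {f g : Fin m → Carrier} → (∀ i → f i ≤ g i) → sum f ≤ sum g
  sum-mono-≤ {ℕ.zero} f≤g = ≤-refl
  sum-mono-≤ {suc m} f≤g = +-mono-≤ (f≤g Fin.zero) (sum-mono-≤ (f≤g ∘ suc))

  busy-cost : ∀ L → (∀ j → Executes j L) → cost I (map run L) ≈ totalDelay L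
  busy-cost L e = sum-cong-≋ λ j → trans (completion≈∑delay 0# L j (e j)) (+-identityˡ _)

  totalDelay≤cost : ∀ {s} → Feasible s → totalDelay (tasks s) ≤ cost I s
  totalDelay≤cost {s} feas = begin
    totalDelay (tasks s)      ≈⟨ busy-cost (tasks s) (feasible⇒executes {s} feas) ⟨
    cost I (map run (tasks s)) ≤⟨ sum-mono-≤ (λ j →
      withoutIdle s j ≤-refl (feasible⇒executes {s} feas j)) ⟩
    cost I s ∎

  module _ {S : Schedule n} (sorted : SORT s s I S) where

    private
      order : Order (map init (allFin n)) (tasks S)
      order = sortRun⇒order sorted

    sort-single : ∀ i → Untested i × tasksOf i S ≡ untested i ∷ [] ⊎
                        Tested i × tasksOf i S ≡ test i ∷ execute i ∷ []
    sort-single i = single (order-project (_≟ i) ([] ∷ []) (≡.refl ∷ [])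
                             (λ { ≡.refl → here ≡.refl }) order)

    sort-feasible : Feasible S
    sort-feasible i = Sum⊎.map proj₂ proj₂ (sort-single i)

    sort-own : ∀ {i x} → WorksFor i x → delay (tasks S) i i ≤ (1# + s) * x
    sort-own {i} works with sort-single i
    ... | inj₁ (untestedᵢ , eq) = ≤-trans (≤-reflexive (trans (ownDelay S eq) (delay-untested i)))
      (≤-trans (u≤s*work untestedᵢ works) (sx≤[1+s]x (works-nonNeg works)))
    ... | inj₂ (testedᵢ , eq)   = ≤-trans (≤-reflexive (trans (ownDelay S eq) (delay-tested i)))
      (t+p≤ testedᵢ works)

    sort-pair : ∀ {i j} → i ≢ j → Bounded i j (pairDelay i j (tasks S))
    sort-pair {i} {j} i≢j works = ≤-trans
      (≤-reflexive (sym (+-cong (delay-filter P? (inj₁ ≡.refl) (inj₂ ≡.refl) (tasks S))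
                                (delay-filter P? (inj₂ ≡.refl) (inj₁ ≡.refl) (tasks S)))))
      (pair-bounded i≢j (order-project P? ((i≢j ∷ []) ∷ [] ∷ []) (inj₁ ≡.refl ∷ inj₂ ≡.refl ∷ [])
        (λ { (inj₁ ≡.refl) → here ≡.refl ; (inj₂ ≡.refl) → there (here ≡.refl) }) order) works)
      where
      P? : Decidable (λ k → k ≡ i ⊎ k ≡ j)
      P? k = (k ≟ i) ⊎-dec (k ≟ j)

    -- Stated for all `i` and `j`, so that the double sums can be compared term by term. Off the
    -- diagonal, one of the two delays in `S′` already contains the full work on a job, and the
    -- other is nonnegative.
    sort-pair≤ : ∀ {S′} → Feasible S′ → ∀ i j →
                 pairDelay i j (tasks S) ≤ (1# + s) * pairDelay i j (tasks S′)
    sort-pair≤ {S′} feas i j with i ≟ j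
    ... | yes ≡.refl = ≤-trans (+-mono-≤ own own) (≤-reflexive (sym (distribˡ _ _ _)))
      where
      own : delay (tasks S) i i ≤ (1# + s) * delay (tasks S′) i i
      own = sort-own (feasible-works {S′} feas i)
    ... | no i≢j with delay-total (tasks S′) i≢j
    ...   | inj₁ full = ≤-trans (sort-pair i≢j (inj₁ (feasible-works {S′} feas i)))
      (*-monoʳ-≤ (+-nonNeg 0≤1 0≤s) (≤-trans full (x≤x+y (delay-nonNeg (tasks S′) j i))))
    ...   | inj₂ full = ≤-trans (sort-pair i≢j (inj₂ (feasible-works {S′} feas j)))
      (*-monoʳ-≤ (+-nonNeg 0≤1 0≤s) (≤-trans full (x≤y+x (delay-nonNeg (tasks S′) i j))))

    -- Summing the pairwise bounds counts each delay twice on both sides; the factor two is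
    -- cancelled at the end.
    sort-totalDelay≤ : ∀ {S′} → Feasible S′ → totalDelay (tasks S) ≤ (1# + s) * totalDelay (tasks S′)
    sort-totalDelay≤ {S′} feas = x+x≤y+y⇒x≤y (begin
      totalDelay (tasks S) + totalDelay (tasks S)
        ≈⟨ ∑pairDelay (tasks S) ⟨
      (sum λ j → sum λ i → pairDelay i j (tasks S))
        ≤⟨ sum-mono-≤ (λ j → sum-mono-≤ λ i → sort-pair≤ {S′} feas i j) ⟩
      (sum λ j → sum λ i → (1# + s) * pairDelay i j (tasks S′))
        ≈⟨ sum-cong-≋ (λ j → *-distribˡ-sum (1# + s) (λ i → pairDelay i j (tasks S′))) ⟨
      (sum λ j → (1# + s) * (sum λ i → pairDelay i j (tasks S′)))
        ≈⟨ *-distribˡ-sum (1# + s) (λ j → sum λ i → pairDelay i j (tasks S′)) ⟨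
      (1# + s) * (sum λ j → sum λ i → pairDelay i j (tasks S′))
        ≈⟨ *-congˡ (∑pairDelay (tasks S′)) ⟩
      (1# + s) * (totalDelay (tasks S′) + totalDelay (tasks S′))
        ≈⟨ distribˡ _ _ _ ⟩
      (1# + s) * totalDelay (tasks S′) + (1# + s) * totalDelay (tasks S′) ∎)

    sort-cost≤ : ∀ {S′} → Feasible S′ → cost I S ≤ (1# + s) * cost I S′
    sort-cost≤ {S′} feas = begin
      cost I S                              ≡⟨ ≡.cong (cost I) (sortRun-busy sorted) ⟩
      cost I (map run (tasks S))            ≈⟨ busy-cost (tasks S) (feasible⇒executes {S} sort-feasible) ⟩
      totalDelay (tasks S)                  ≤⟨ sort-totalDelay≤ {S′} feas ⟩
      (1# + s) * totalDelay (tasks S′)      ≤⟨ *-monoʳ-≤ (+-nonNeg 0≤1 0≤s) (totalDelay≤cost {S′} feas) ⟩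
      (1# + s) * cost I S′                  ∎

corollary4 : ∀ {c ℓ₁ ℓ₂} (R : EuclideanField c ℓ₁ ℓ₂) →
    let open EuclideanField R
        open Scheduling R
    in Competitive (SORT (√ 2#) (√ 2#)) (1# + √ 2#)
       × IsMinimizer ratioBound (√ 2#) (√ 2#)
corollary4 R =
  (λ I S sorted → sort-feasible I sorted ,
     λ opt optimal → sort-cost≤ I sorted {opt} (IsOptimal.feasible optimal)) ,
  SquareRootOf2.ratioBound-minimized R
  where
  open Scheduling R using (module IsOptimal)
  open SortAnalysis R using (sort-feasible; sort-cost≤)
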